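{- Let $X$ be a connected bipartite vertex-transitive graph of order $n$ that is regular of degree $d$. If there exists a semiregular subgroup $H\le \mathrm{Aut}(X)$ of order $\frac{n}{2d}$ such that the quotient graph $X_H$ is a simple graph isomorphic to the complete bipartite graph $K_{d,d}$, then $X$ is a $d$-RDR graph.
   Context: All graphs are finite and simple. For a graph $G=(V,E)$, $N(v)$ is the open neighbourhood of $v$. Let $\mathcal K=\{1,\dots,k\}$. A $k$-rainbow dominating function ($k$-RDF) on $G$ is a map $f\colon V\to 2^{\mathcal K}$ such that $f(v)=\emptyset$ implies $\bigcup_{u\in N(v)}f(u)=\mathcal K$, for all $v\in V$. Its weight is $\sum_{v\in V}|f(v)|$, and $\gamma_{rk}(G)$ is the minimum weight of a $k$-RDF on $G$. It is known that a $d$-regular graph $G$ of order $n$ satisfies $\gamma_{rd}(G)\ge n/2$; it is called $d$-rainbow domination regular ($d$-RDR) if $\gamma_{rd}(G)=n/2$. A graph is vertex-transitive if its automorphism group acts transitively on its vertices. A subgroup $H\le\mathrm{Aut}(X)$ is semiregular if only the identity of $H$ fixes a vertex. The quotient graph $X_H$ has as vertices the orbits of $H$ on $V(X)$, two orbits being adjacent if there is an edge of $X$ with one endpoint in each of them. -}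

module Defs where

open import Algebra.Bundles using (Group)
open import Data.Fin.Base using (Fin)
open import Data.Fin.Subset using (Subset; ⊥; ⊤; ⋃; ∣_∣; _∈_; _∉_)
open import Data.List.Base using (List; allFin; filter; length; map; sum)
open import Data.Nat.Base using (ℕ; _≤_; _*_)
open import Data.Product.Base using (Σ; ∃; ∃₂; _×_; _,_; proj₁)
open import Data.Sum.Base using (_⊎_; inj₁; inj₂)
open import Function.Base using (_∘_)
open import Function.Bundles using (Inverse; _⇔_; mk⇔; Equivalence)
import Function.Construct.Composition as Compose
import Function.Construct.Identity as Identity
import Function.Construct.Symmetry as Symmetry
open import Level using (0ℓ)
open import Relation.Binary.Bundles using (Setoid)
open import Relation.Binary.Core using (Rel)
open import Relation.Binary.Definitions
  using (Decidable; Irreflexive; Symmetric; _Respects₂_)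
import Relation.Binary.Construct.On as On
open import Relation.Binary.Construct.Closure.ReflexiveTransitive using (Star)
open import Relation.Binary.PropositionalEquality
  using (_≡_; refl; sym; trans; cong; subst₂; setoid; resp₂)
open import Relation.Unary using (Pred)

-- Graphs over a setoid of vertices, so that a quotient graph is again a
-- graph.  Loops are allowed here: a quotient graph may a priori have them.

record Graph : Set₁ where
  infix 4 _~_
  field
    vertices : Setoid 0ℓ 0ℓ
  open Setoid vertices public using (_≈_) renaming (Carrier to Vertex)
  field
    _~_      : Rel Vertex 0ℓ
    ~-sym    : Symmetric _~_
    ~-resp-≈ : _~_ Respects₂ _≈_

Simple : Graph → Set
Simple G = Irreflexive _≈_ _~_
  where open Graph G

infix 4 _≅_

record _≅_ (G H : Graph) : Set where
  private
    module G = Graph G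
    module H = Graph H
  field
    bijection : Inverse G.vertices H.vertices
  open Inverse bijection public
  field
    adjacency : ∀ u v → u G.~ v ⇔ to u H.~ to v

data CompleteBipartiteAdj {A B : Set} : Rel (A ⊎ B) 0ℓ where
  left-right : ∀ a b → CompleteBipartiteAdj (inj₁ a) (inj₂ b)
  right-left : ∀ a b → CompleteBipartiteAdj (inj₂ b) (inj₁ a)

completeBipartite : ℕ → ℕ → Graph
completeBipartite m n = record
  { vertices = setoid (Fin m ⊎ Fin n)
  ; _~_      = CompleteBipartiteAdj
  ; ~-sym    = λ { (left-right a b) → right-left a b
                 ; (right-left a b) → left-right a b }
  ; ~-resp-≈ = resp₂ CompleteBipartiteAdj
  }

record SimpleGraph (n : ℕ) : Set₁ where
  infix 4 _~_ _~?_
  field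
    _~_      : Rel (Fin n) 0ℓ
    _~?_     : Decidable _~_
    ~-sym    : Symmetric _~_
    ~-irrefl : Irreflexive _≡_ _~_

  graph : Graph
  graph = record
    { vertices = setoid (Fin n)
    ; _~_      = _~_
    ; ~-sym    = ~-sym
    ; ~-resp-≈ = resp₂ _~_
    }

  N : Fin n → List (Fin n)
  N v = filter (v ~?_) (allFin n)

module _ {n : ℕ} (X : SimpleGraph n) where
  open SimpleGraph X

  Regular : ℕ → Set
  Regular d = ∀ v → length (N v) ≡ d

  Connected : Set
  Connected = ∀ u v → Star _~_ u v

  Bipartite : Set
  Bipartite = ∃ λ (A : Subset n) →
    ∀ {u v} → u ~ v → (u ∈ A × v ∉ A) ⊎ (u ∉ A × v ∈ A)

  -- (g ∙ h) v = g (h v); automorphisms are compared pointwise.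

  Aut : Group 0ℓ 0ℓ
  Aut = record
    { Carrier = graph ≅ graph
    ; _≈_     = λ g h → ∀ v → to g v ≡ to h v
    ; _∙_     = _∙_
    ; ε       = ε
    ; _⁻¹     = _⁻¹
    ; isGroup = record
      { isMonoid = record
        { isSemigroup = record
          { isMagma = record
            { isEquivalence = record
              { refl  = λ v → refl
              ; sym   = λ p v → sym (p v)
              ; trans = λ p q v → trans (p v) (q v)
              }
            ; ∙-cong = λ {g} {g′} {h} {h′} p q v →
                trans (cong (to g) (q v)) (p (to h′ v))
            }
          ; assoc = λ f g h v → refl
          }
        ; identity = (λ g v → refl) , (λ g v → refl)
        }
      ; inverse = (λ g v → strictlyInverseʳ g v)
                , (λ g v → strictlyInverseˡ g v)
      ; ⁻¹-cong = λ {g} {h} p v →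
          trans (sym (strictlyInverseʳ h (from g v)))
                (cong (from h) (trans (sym (p (from g v)))
                                      (strictlyInverseˡ g v)))
      }
    }
    where
    open _≅_
    open Equivalence renaming (to to ⇒; from to ⇐)

    _∙_ : graph ≅ graph → graph ≅ graph → graph ≅ graph
    g ∙ h = record
      { bijection = Compose.inverse (bijection h) (bijection g)
      ; adjacency = λ u v → mk⇔
          (⇒ (adjacency g (to h u) (to h v)) ∘ ⇒ (adjacency h u v))
          (⇐ (adjacency h u v) ∘ ⇐ (adjacency g (to h u) (to h v)))
      }

    ε : graph ≅ graph
    ε = record
      { bijection = Identity.inverse (setoid (Fin n))
      ; adjacency = λ u v → mk⇔ (λ p → p) (λ p → p)
      }

    _⁻¹ : graph ≅ graph → graph ≅ graph
    g ⁻¹ = record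
      { bijection = Symmetry.inverse (bijection g)
      ; adjacency = λ u v → mk⇔
          (λ p → ⇐ (adjacency g (from g u) (from g v))
            (subst₂ _~_ (sym (strictlyInverseˡ g u))
                        (sym (strictlyInverseˡ g v)) p))
          (λ p → subst₂ _~_ (strictlyInverseˡ g u) (strictlyInverseˡ g v)
            (⇒ (adjacency g (from g u) (from g v)) p))
      }

  VertexTransitive : Set
  VertexTransitive = ∀ u v → ∃ λ (g : Group.Carrier Aut) → _≅_.to g u ≡ v

record Subgroup (G : Group 0ℓ 0ℓ) : Set₁ where
  open Group G using (Carrier; _≈_; _∙_; ε; _⁻¹)
  field
    Member    : Pred Carrier 0ℓ
    resp      : ∀ {g h} → g ≈ h → Member g → Member h
    ∙-closed  : ∀ {g h} → Member g → Member h → Member (g ∙ h)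
    ε-closed  : Member ε
    ⁻¹-closed : ∀ {g} → Member g → Member (g ⁻¹)

  elements : Setoid 0ℓ 0ℓ
  elements = On.setoid {B = Σ Carrier Member} (Group.setoid G) proj₁

  HasOrder : ℕ → Set
  HasOrder m = Inverse (setoid (Fin m)) elements

module _ {n : ℕ} (X : SimpleGraph n) (H : Subgroup (Aut X)) where
  open SimpleGraph X
  open Group (Aut X) using (_≈_; ε; _∙_; _⁻¹)
  open Subgroup H
  open _≅_ using (to; strictlyInverseʳ)

  Semiregular : Set
  Semiregular = ∀ h → Member h → ∀ v → to h v ≡ v → h ≈ ε

  -- An orbit is presented by any of its vertices.

  SameOrbit : Rel (Fin n) 0ℓ
  SameOrbit u v = ∃ λ h → Member h × to h u ≡ v

  orbits : Setoid 0ℓ 0ℓ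
  orbits = record
    { Carrier       = Fin n
    ; _≈_           = SameOrbit
    ; isEquivalence = record { refl = so-refl ; sym = so-sym ; trans = so-trans }
    }
    where
    so-refl : ∀ {u} → SameOrbit u u
    so-refl = ε , ε-closed , refl

    so-sym : Symmetric SameOrbit
    so-sym {u} (h , h∈H , refl) = h ⁻¹ , ⁻¹-closed h∈H , strictlyInverseʳ h u

    so-trans : ∀ {u v w} → SameOrbit u v → SameOrbit v w → SameOrbit u w
    so-trans (h , h∈H , refl) (g , g∈H , q) = g ∙ h , ∙-closed g∈H h∈H , q

  quotientGraph : Graph
  quotientGraph = record
    { vertices = orbits
    ; _~_      = λ u v → ∃₂ λ u′ v′ → SameOrbit u u′ × SameOrbit v v′ × u′ ~ v′
    ; ~-sym    = λ (u′ , v′ , p , q , e) → v′ , u′ , q , p , ~-sym e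
    ; ~-resp-≈ =
        (λ r (u′ , v′ , p , q , e) → u′ , v′ , p , O.trans (O.sym r) q , e)
      , (λ r (u′ , v′ , p , q , e) → u′ , v′ , O.trans (O.sym r) p , q , e)
    }
    where module O = Setoid orbits

-- The colour set is Fin k, and Subset k plays the role of its power set.

module _ {n : ℕ} (k : ℕ) (X : SimpleGraph n) where
  open SimpleGraph X

  IsRainbowDominating : (Fin n → Subset k) → Set
  IsRainbowDominating f = ∀ v → f v ≡ ⊥ → ⋃ (map f (N v)) ≡ ⊤

  weight : (Fin n → Subset k) → ℕ
  weight f = sum (map (∣_∣ ∘ f) (allFin n))

  IsRainbowDominationNumber : ℕ → Set
  IsRainbowDominationNumber γ =
      (∃ λ f → IsRainbowDominating f × weight f ≡ γ)
    × (∀ f → IsRainbowDominating f → γ ≤ weight f)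

RainbowDominationRegular : ∀ {n} → ℕ → SimpleGraph n → Set
RainbowDominationRegular {n} d X =
  Regular X d × ∃ λ γ → IsRainbowDominationNumber d X γ × 2 * γ ≡ n

{-# OPTIONS --safe #-}

-- Giving every vertex v weight w(v), the sum over all v of
-- d · w(v) + Σ_{u ∈ N(v)} w(u) equals 2 d · Σ_v w(v) in a d-regular graph.
-- With w = |f| for a rainbow dominating f every summand is at least d, which
-- is the lower bound n / 2.  Equality is attained by the colouring pulled back
-- from K_{d,d}: the i-th vertex on the left gets {i}, the right side gets ∅.
-- Edges of X lie over edges of K_{d,d}, so each summand is exactly d; and a
-- vertex on the right has a neighbour in every orbit on the left, since an
-- edge between two orbits can be moved by H to any endpoint in either of them.

module Submission where

open import Defs
open import Data.Empty using (⊥-elim)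
open import Data.Fin.Base using (Fin)
open import Data.Fin.Properties using (nonZeroIndex)
open import Data.Fin.Subset
  using (Subset; inside; outside; ⊥; ⊤; ⁅_⁆; _∪_; ⋃; ∣_∣; _∈_)
open import Data.Fin.Subset.Properties
  using (∣⊥∣≡0; ∣⊤∣≡n; ∣⁅x⁆∣≡1; ∉⊥; ⊆⊤; ⊆-antisym; x∈⁅x⁆; x∈p∪q⁺;
         nonempty?; Empty-unique; x∈⁅y⁆⇒x≡y; p⊆q⇒∣p∣≤∣q∣)
open import Data.List.Base using (List; []; _∷_; allFin; filter; length; map)
import Data.List.Membership.Propositional as List
open import Data.List.Membership.Propositional.Properties
  using (∈-allFin; ∈-filter⁺; ∈-map⁺)
open import Data.List.Properties
  using (filter-≐; length-tabulate; map-cong; map-cong-local)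
import Data.List.Relation.Unary.All as All
open import Data.List.Relation.Unary.All.Properties using (all-filter)
open import Data.List.Relation.Unary.Any using (here; there)
open import Data.Nat.Base
  using (ℕ; zero; suc; _+_; _*_; _≤_; z≤n; s≤s; NonZero)
open import Data.Nat.ListAction using (sum)
open import Data.Nat.Properties
  using (≤-trans; ≤-reflexive; module ≤-Reasoning; n≤1+n; m≤m+n; m≤n+m;
         +-comm; +-suc; +-mono-≤; +-monoʳ-≤; *-comm; *-identityˡ; *-identityʳ;
         *-zeroʳ; *-distribʳ-+; *-monoˡ-≤; *-cancelˡ-≤; *-cancelʳ-≤; *-cancelʳ-≡)
open import Data.Nat.Solver using (module +-*-Solver)
open import Data.Product.Base using (∃; _×_; _,_; proj₁; proj₂)
open import Data.Sum.Base using (_⊎_; inj₁; inj₂; [_,_])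
open import Data.Vec.Base using ([]; _∷_)
open import Function.Base using (_∘_; id)
open import Function.Bundles using (Equivalence)
open import Level using (0ℓ)
open import Relation.Binary.Bundles using (Setoid)
open import Relation.Binary.Core using (REL)
open import Relation.Binary.Definitions using (Decidable)
open import Relation.Binary.PropositionalEquality
  using (_≡_; _≢_; refl; sym; trans; cong; cong₂; subst; subst₂; module ≡-Reasoning)
open import Relation.Nullary.Decidable using (yes; no)

private
  variable
    A B : Set
    k n : ℕ

-- Finite sums and double counting.

sum-map-+ : ∀ (f g : A → ℕ) xs →
  sum (map (λ x → f x + g x) xs) ≡ sum (map f xs) + sum (map g xs)
sum-map-+ f g []       = refl
sum-map-+ f g (x ∷ xs) = begin
  f x + g x + sum (map (λ y → f y + g y) xs)
    ≡⟨ cong (f x + g x +_) (sum-map-+ f g xs) ⟩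
  f x + g x + (sum (map f xs) + sum (map g xs))
    ≡⟨ solve 4 (λ a b c e → a :+ b :+ (c :+ e) := a :+ c :+ (b :+ e)) refl
         (f x) (g x) (sum (map f xs)) (sum (map g xs)) ⟩
  f x + sum (map f xs) + (g x + sum (map g xs)) ∎
  where
  open ≡-Reasoning
  open +-*-Solver

sum-map-*ʳ : ∀ (f : A → ℕ) c xs →
  sum (map (λ x → f x * c) xs) ≡ sum (map f xs) * c
sum-map-*ʳ f c []       = refl
sum-map-*ʳ f c (x ∷ xs) =
  trans (cong (f x * c +_) (sum-map-*ʳ f c xs)) (sym (*-distribʳ-+ c (f x) _))

sum-map-const : ∀ c (xs : List A) → sum (map (λ _ → c) xs) ≡ length xs * c
sum-map-const c []       = refl
sum-map-const c (x ∷ xs) = cong (c +_) (sum-map-const c xs)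

sum-map-mono : ∀ {f g : A → ℕ} → (∀ x → f x ≤ g x) →
  ∀ xs → sum (map f xs) ≤ sum (map g xs)
sum-map-mono f≤g []       = z≤n
sum-map-mono f≤g (x ∷ xs) = +-mono-≤ (f≤g x) (sum-map-mono f≤g xs)

module _ {R : REL A B 0ℓ} (R? : Decidable R) where

  -- Read `R` as a 0/1 matrix with rows from `A` and columns from `B`: this is a column sum, and
  -- `rowSum` below is a row sum weighted by `w`.
  indegree : List A → B → ℕ
  indegree ys x = length (filter (λ y → R? y x) ys)

  module _ (w : B → ℕ) where

    rowSum : List B → A → ℕ
    rowSum xs y = sum (map w (filter (R? y) xs))

    sum-rowSum-∷ : ∀ x xs ys →
      sum (map (rowSum (x ∷ xs)) ys) ≡ w x * indegree ys x + sum (map (rowSum xs) ys)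
    sum-rowSum-∷ x xs []       = cong (_+ 0) (sym (*-zeroʳ (w x)))
    -- The one decision `R? y x` settles both whether `w x` enters the row of `y` and whether `y`
    -- counts towards the column of `x`.
    sum-rowSum-∷ x xs (y ∷ ys) with ih ← sum-rowSum-∷ x xs ys | R? y x
    ... | yes _ = trans (cong (w x + rowSum xs y +_) ih)
      (solve 4 (λ a b c e → a :+ b :+ (a :* c :+ e) := a :* (con 1 :+ c) :+ (b :+ e))
         refl (w x) (rowSum xs y) (indegree ys x) (sum (map (rowSum xs) ys)))
      where open +-*-Solver
    ... | no  _ = trans (cong (rowSum xs y +_) ih)
      (solve 3 (λ a b c → a :+ (b :+ c) := b :+ (a :+ c))
         refl (rowSum xs y) (w x * indegree ys x) (sum (map (rowSum xs) ys)))
      where open +-*-Solver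

    -- Both sides add `w x` over all related pairs, by rows on the left and by columns on the right.
    -- Keeping the two lists separate allows induction on the columns with the rows fixed.
    double-counting : ∀ xs ys →
      sum (map (rowSum xs) ys) ≡ sum (map (λ x → w x * indegree ys x) xs)
    double-counting []       ys = trans (sum-map-const 0 ys) (*-zeroʳ (length ys))
    double-counting (x ∷ xs) ys =
      trans (sum-rowSum-∷ x xs ys) (cong (_ +_) (double-counting xs ys))

-- Cardinalities and unions of colour sets.

∣p∪q∣≤∣p∣+∣q∣ : ∀ (p q : Subset n) → ∣ p ∪ q ∣ ≤ ∣ p ∣ + ∣ q ∣
∣p∪q∣≤∣p∣+∣q∣ []            []            = z≤n
∣p∪q∣≤∣p∣+∣q∣ (outside ∷ p) (outside ∷ q) = ∣p∪q∣≤∣p∣+∣q∣ p q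
∣p∪q∣≤∣p∣+∣q∣ (outside ∷ p) (inside  ∷ q) =
  ≤-trans (s≤s (∣p∪q∣≤∣p∣+∣q∣ p q)) (≤-reflexive (sym (+-suc ∣ p ∣ ∣ q ∣)))
∣p∪q∣≤∣p∣+∣q∣ (inside  ∷ p) (outside ∷ q) = s≤s (∣p∪q∣≤∣p∣+∣q∣ p q)
-- A common element is counted twice on the right, which leaves a slack of one.
∣p∪q∣≤∣p∣+∣q∣ (inside  ∷ p) (inside  ∷ q) =
  s≤s (≤-trans (∣p∪q∣≤∣p∣+∣q∣ p q) (+-monoʳ-≤ ∣ p ∣ (n≤1+n ∣ q ∣)))

∣⋃∣≤sum : ∀ (f : A → Subset n) xs → ∣ ⋃ (map f xs) ∣ ≤ sum (map (∣_∣ ∘ f) xs)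
∣⋃∣≤sum {n = n} f []   = ≤-reflexive (∣⊥∣≡0 n)
∣⋃∣≤sum f (x ∷ xs) =
  ≤-trans (∣p∪q∣≤∣p∣+∣q∣ (f x) _) (+-monoʳ-≤ ∣ f x ∣ (∣⋃∣≤sum f xs))

x∈⋃⁺ : ∀ {x : Fin n} {p ps} → p List.∈ ps → x ∈ p → x ∈ ⋃ ps
x∈⋃⁺ (here refl)  x∈p = x∈p∪q⁺ (inj₁ x∈p)
x∈⋃⁺ (there p∈ps) x∈p = x∈p∪q⁺ (inj₂ (x∈⋃⁺ p∈ps x∈p))

x∈p⇒1≤∣p∣ : ∀ {x : Fin n} {p} → x ∈ p → 1 ≤ ∣ p ∣
x∈p⇒1≤∣p∣ {x = x} {p} x∈p =
  subst (_≤ ∣ p ∣) (∣⁅x⁆∣≡1 x) (p⊆q⇒∣p∣≤∣q∣ λ y∈⁅x⁆ →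
    subst (_∈ p) (sym (x∈⁅y⁆⇒x≡y x y∈⁅x⁆)) x∈p)

⁅x⁆≢⊥ : ∀ {x : Fin n} → ⁅ x ⁆ ≢ ⊥
⁅x⁆≢⊥ {x = x} eq = ∉⊥ (subst (x ∈_) eq (x∈⁅x⁆ x))

-- Weight counts in a regular graph.

module _ {n : ℕ} (X : SimpleGraph n) where
  open SimpleGraph X

  ∈-N : ∀ {u v} → v ~ u → u List.∈ N v
  ∈-N {u} {v} v~u = ∈-filter⁺ (v ~?_) (∈-allFin u) v~u

  module _ {d : ℕ} (reg : Regular X d) where

    -- Each `w u` is collected once by each of the `d` neighbours of `u`, and `d` times more by the
    -- term of `u` itself.
    sum-closed-neighbourhoods : ∀ (w : Fin n → ℕ) →
      sum (map (λ v → sum (map w (N v)) + w v * d) (allFin n))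
      ≡ 2 * sum (map w (allFin n)) * d
    sum-closed-neighbourhoods w = begin
      sum (map (λ v → sum (map w (N v)) + w v * d) V)
        ≡⟨ sum-map-+ _ _ V ⟩
      sum (map (λ v → sum (map w (N v))) V) + sum (map (λ v → w v * d) V)
        ≡⟨ cong (_+ _) (double-counting _~?_ w V V) ⟩
      sum (map (λ u → w u * indegree _~?_ V u) V) + sum (map (λ v → w v * d) V)
        ≡⟨ cong (λ ws → sum ws + _) (map-cong (λ u → cong (w u *_) (indegree≡d u)) V) ⟩
      sum (map (λ v → w v * d) V) + sum (map (λ v → w v * d) V)
        ≡⟨ cong₂ _+_ (sum-map-*ʳ w d V) (sum-map-*ʳ w d V) ⟩
      W * d + W * d
        ≡⟨ solve 2 (λ a b → a :* b :+ a :* b := con 2 :* a :* b) refl W d ⟩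
      2 * W * d ∎
      where
      open ≡-Reasoning
      open +-*-Solver
      V = allFin n
      W = sum (map w V)
      -- `indegree` counts edges into `u` and `N u` counts edges out of it; symmetry identifies the
      -- two.
      indegree≡d : ∀ u → indegree _~?_ V u ≡ d
      indegree≡d u = trans
        (cong length (filter-≐ (_~? u) (u ~?_) (~-sym , ~-sym) V)) (reg u)

    sum-const-V : sum (map (λ _ → d) (allFin n)) ≡ n * d
    sum-const-V = trans (sum-map-const d (allFin n)) (cong (_* d) (length-tabulate {n = n} id))

    order≤2*weight : .{{NonZero d}} → ∀ f → IsRainbowDominating d X f →
      n ≤ 2 * weight d X f
    order≤2*weight f dom = *-cancelʳ-≤ n (2 * weight d X f) d (begin
      n * d                                              ≡⟨ sum-const-V ⟨
      sum (map (λ _ → d) (allFin n))                     ≤⟨ sum-map-mono local (allFin n) ⟩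
      sum (map (λ v → sum (map w (N v)) + w v * d) (allFin n))
                                                         ≡⟨ sum-closed-neighbourhoods w ⟩
      2 * weight d X f * d                               ∎)
      where
      open ≤-Reasoning
      w = ∣_∣ ∘ f
      local : ∀ v → d ≤ sum (map w (N v)) + w v * d
      local v with nonempty? (f v)
      -- A coloured vertex reaches `d` through its own term alone.
      ... | yes (_ , x∈fv) = begin
        d                              ≡⟨ *-identityˡ d ⟨
        1 * d                          ≤⟨ *-monoˡ-≤ d (x∈p⇒1≤∣p∣ x∈fv) ⟩
        w v * d                        ≤⟨ m≤n+m (w v * d) _ ⟩
        sum (map w (N v)) + w v * d    ∎
      -- The neighbours of an uncoloured vertex carry all `d` colours between them.
      ... | no empty = begin
        d                              ≡⟨ ∣⊤∣≡n d ⟨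
        ∣ ⊤ {d} ∣                      ≡⟨ cong ∣_∣ (dom v (Empty-unique empty)) ⟨
        ∣ ⋃ (map f (N v)) ∣            ≤⟨ ∣⋃∣≤sum f (N v) ⟩
        sum (map w (N v))              ≤⟨ m≤m+n _ (w v * d) ⟩
        sum (map w (N v)) + w v * d    ∎

    2*weight≡order : .{{NonZero d}} → ∀ (f : Fin n → Subset d) →
      (∀ {u v} → u ~ v → ∣ f u ∣ + ∣ f v ∣ ≡ 1) → 2 * weight d X f ≡ n
    2*weight≡order f edge = *-cancelʳ-≡ (2 * weight d X f) n d (begin
      2 * weight d X f * d   ≡⟨ sum-closed-neighbourhoods w ⟨
      sum (map (λ v → sum (map w (N v)) + w v * d) (allFin n))
                             ≡⟨ cong sum (map-cong local (allFin n)) ⟩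
      sum (map (λ _ → d) (allFin n))
                             ≡⟨ sum-const-V ⟩
      n * d                  ∎)
      where
      open ≡-Reasoning
      w = ∣_∣ ∘ f
      -- As `v` has `d` neighbours, `w v * d` splits into one `w v` for each neighbour `u`, and each
      -- `w v + w u` is 1.
      local : ∀ v → sum (map w (N v)) + w v * d ≡ d
      local v = begin
        sum (map w (N v)) + w v * d
          ≡⟨ +-comm (sum (map w (N v))) (w v * d) ⟩
        w v * d + sum (map w (N v))
          ≡⟨ cong (_+ sum (map w (N v))) (trans (*-comm (w v) d) (cong (_* w v) (sym (reg v)))) ⟩
        length (N v) * w v + sum (map w (N v))
          ≡⟨ cong (_+ sum (map w (N v))) (sum-map-const (w v) (N v)) ⟨
        sum (map (λ _ → w v) (N v)) + sum (map w (N v))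
          ≡⟨ sum-map-+ _ w (N v) ⟨
        sum (map (λ u → w v + w u) (N v))
          ≡⟨ cong sum (map-cong-local (All.map edge (all-filter (v ~?_) (allFin n)))) ⟩
        sum (map (λ _ → 1) (N v))
          ≡⟨ trans (sum-map-const 1 (N v)) (*-identityʳ _) ⟩
        length (N v)
          ≡⟨ reg v ⟩
        d ∎

-- Edges of the quotient and their lifts.

module _ {n : ℕ} (X : SimpleGraph n) (H : Subgroup (Aut X)) where
  open SimpleGraph X
  private
    module O = Setoid (orbits X H)
    module Q = Graph (quotientGraph X H)

  ~⇒quotient~ : ∀ {u v} → u ~ v → u Q.~ v
  ~⇒quotient~ {u} {v} u~v = u , v , O.refl , O.refl , u~v

  -- Some `h` in `H` takes `v` to the endpoint `v₁` of the given edge. Pulling that edge back along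
  -- `h` makes `v` an endpoint and keeps the other endpoint in its orbit.
  lift-edge : ∀ {u v} → u Q.~ v → ∃ λ u′ → u′ O.≈ u × v ~ u′
  lift-edge {u} {v} (u₁ , v₁ , u≈u₁ , (h , h∈H , hv≡v₁) , u₁~v₁) =
      from u₁
    , O.trans (h , h∈H , strictlyInverseˡ u₁) (O.sym u≈u₁)
    , Equivalence.from (adjacency v (from u₁))
        (subst₂ _~_ (sym hv≡v₁) (sym (strictlyInverseˡ u₁)) (~-sym u₁~v₁))
    where open _≅_ h

-- The colouring pulled back from the complete bipartite graph.

colour : Fin k ⊎ Fin k → Subset k
colour = [ ⁅_⁆ , (λ _ → ⊥) ]

∣colour∣-edge : ∀ {x y : Fin k ⊎ Fin k} → CompleteBipartiteAdj x y →
  ∣ colour x ∣ + ∣ colour y ∣ ≡ 1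
∣colour∣-edge {k} (left-right i j) = cong₂ _+_ (∣⁅x⁆∣≡1 i) (∣⊥∣≡0 k)
∣colour∣-edge {k} (right-left i j) = cong₂ _+_ (∣⊥∣≡0 k) (∣⁅x⁆∣≡1 i)

module _ {n d : ℕ} (X : SimpleGraph n) (H : Subgroup (Aut X))
         (iso : quotientGraph X H ≅ completeBipartite d d) where
  open SimpleGraph X
  open _≅_ iso

  pullback : Fin n → Subset d
  pullback = colour ∘ to

  ∣pullback∣-edge : ∀ {u v} → u ~ v → ∣ pullback u ∣ + ∣ pullback v ∣ ≡ 1
  ∣pullback∣-edge {u} {v} u~v =
    ∣colour∣-edge (Equivalence.to (adjacency u v) (~⇒quotient~ X H u~v))

  -- The edge joining `inj₁ i` to `inj₂ j`, transported to the quotient, lifts to an edge at `v`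
  -- itself and not just at some vertex of its orbit.
  right-sees-left : ∀ v {j} → to v ≡ inj₂ j → ∀ i → ∃ λ u → v ~ u × to u ≡ inj₁ i
  right-sees-left v {j} tov≡j i =
    u , v~u , trans (to-cong u≈x) (strictlyInverseˡ (inj₁ i))
    where
    x = from (inj₁ i)
    lifted = lift-edge X H (Equivalence.from (adjacency x v)
      (subst₂ CompleteBipartiteAdj (sym (strictlyInverseˡ (inj₁ i))) (sym tov≡j)
              (left-right i j)))
    u = proj₁ lifted
    u≈x = proj₁ (proj₂ lifted)
    v~u = proj₂ (proj₂ lifted)

  pullback-dominating : IsRainbowDominating d X pullback
  pullback-dominating v fv≡⊥ with to v in tov≡
  -- A left vertex carries a singleton, so only right vertices need covering.
  ... | inj₁ i = ⊥-elim (⁅x⁆≢⊥ fv≡⊥)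
  ... | inj₂ j = ⊆-antisym ⊆⊤ λ {i} _ → let (u , v~u , tou≡i) = right-sees-left v tov≡ i in
    x∈⋃⁺ (∈-map⁺ pullback (∈-N X v~u))
         (subst (λ y → i ∈ colour y) (sym tou≡i) (x∈⁅x⁆ i))

  -- The image of a vertex inhabits one of the two copies of `Fin d`. This justifies cancelling `d`
  -- in both counts.
  vertex⇒nonZero : Fin n → NonZero d
  vertex⇒nonZero v = [ nonZeroIndex , nonZeroIndex ] (to v)

theorem3p2 : (n d : ℕ) (X : SimpleGraph n) →
    Connected X →
    Bipartite X →
    VertexTransitive X →
    Regular X d →
    (H : Subgroup (Aut X)) (m : ℕ) →
    Semiregular X H →
    Subgroup.HasOrder H m →
    m * (2 * d) ≡ n →
    Simple (quotientGraph X H) →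
    quotientGraph X H ≅ completeBipartite d d →
    RainbowDominationRegular d X
-- The empty graph offers no vertex to show `d` nonzero; its only colouring has weight 0.
theorem3p2 zero d X _ _ _ reg _ _ _ _ _ _ _ =
  reg , 0 , (((λ ()) , (λ ()) , refl) , λ _ _ → z≤n) , refl
theorem3p2 (suc n) d X _ _ _ reg H _ _ _ _ _ iso =
    reg
  , weight d X f
  , ((f , pullback-dominating X H iso , refl)
    -- Twice the weight of `f` is the order, hence at most twice the weight of `g`; halving gives
    -- minimality.
    , λ g dom → *-cancelˡ-≤ 2 (≤-trans (≤-reflexive 2w≡) (order≤2*weight X reg g dom)))
  , 2w≡
  where
  instance d≢0 = vertex⇒nonZero X H iso Fin.zero
  f = pullback X H iso
  2w≡ : 2 * weight d X f ≡ suc n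
  2w≡ = 2*weight≡order X reg f (∣pullback∣-edge X H iso)
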